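{- For every integer $k\ge 0$, $|I_k(231,312)|=|I_k(12)|$.
   Context: A permutation of length $n$ is a word $\pi=\pi_1\cdots\pi_n$ containing each of $1,\dots,n$ exactly once. The sum of permutations $\rho=\rho_1\cdots\rho_n$ and $\tau=\tau_1\cdots\tau_m$ is the permutation $\rho\oplus\tau=\rho_1\cdots\rho_n(n+\tau_1)\cdots(n+\tau_m)$ of length $n+m$. A permutation is decomposable if it equals $\rho\oplus\tau$ for some non-empty permutations $\rho,\tau$; a non-empty permutation that is not decomposable is indecomposable. An inversion of $\pi$ is a pair $(i,j)$ with $i<j$ and $\pi_i>\pi_j$. A permutation $\pi$ contains a permutation (pattern) $\tau=\tau_1\cdots\tau_m$ if there are indices $i_1<\dots<i_m$ such that $\pi_{i_1},\dots,\pi_{i_m}$ is order-isomorphic to $\tau_1,\dots,\tau_m$; otherwise $\pi$ avoids $\tau$. $I_k(\tau_1,\dots,\tau_r)$ denotes the (finite) set of all indecomposable permutations, of any length, with exactly $k$ inversions that avoid all of $\tau_1,\dots,\tau_r$. -}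

module Defs where

open import Data.Fin using (Fin) renaming (_<_ to _<ᶠ_; _<?_ to _<ᶠ?_)
open import Data.List using (List; []; _++_; map; length; lookup; upTo; allFin; filter; cartesianProduct)
open import Data.List.Membership.Propositional using (_∈_)
open import Data.List.Relation.Binary.Permutation.Propositional using (_↭_)
open import Data.List.Relation.Unary.All using (All)
open import Data.List.Relation.Unary.Unique.Propositional using (Unique)
open import Data.Nat using (ℕ; suc; _+_; _<_; _<?_)
open import Data.Product using (∃-syntax; Σ-syntax; _×_; _,_)
open import Function.Bundles using (_⇔_)
open import Level using (0ℓ)
open import Relation.Binary.PropositionalEquality using (_≡_; _≢_)
open import Relation.Nullary using (¬_; Dec)
open import Relation.Nullary.Decidable using (_×-dec_)
open import Relation.Unary using (Pred)

-- Values are 1-based, as in one-line notation; positions (Fin) are 0-based.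
Word : Set
Word = List ℕ

IsPermutation : Pred Word 0ℓ
IsPermutation π = π ↭ map suc (upTo (length π))

infixr 6 _⊕_

_⊕_ : Word → Word → Word
ρ ⊕ τ = ρ ++ map (length ρ +_) τ

Decomposable : Pred Word 0ℓ
Decomposable π = ∃[ ρ ] ∃[ τ ]
  IsPermutation ρ × IsPermutation τ × ρ ≢ [] × τ ≢ [] × π ≡ ρ ⊕ τ

Indecomposable : Pred Word 0ℓ
Indecomposable π = π ≢ [] × ¬ Decomposable π

IsInversion : (π : Word) → Pred (Fin (length π) × Fin (length π)) 0ℓ
IsInversion π (i , j) = i <ᶠ j × lookup π j < lookup π i

isInversion? : (π : Word) → ∀ p → Dec (IsInversion π p)
isInversion? π (i , j) = (i <ᶠ? j) ×-dec (lookup π j <? lookup π i)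

inversions : (π : Word) → List (Fin (length π) × Fin (length π))
inversions π =
  filter (isInversion? π) (cartesianProduct (allFin (length π)) (allFin (length π)))

Contains : Word → Word → Set
Contains π τ = Σ[ f ∈ (Fin (length τ) → Fin (length π)) ]
  (∀ (i j : Fin (length τ)) → i <ᶠ j → f i <ᶠ f j) ×
  (∀ (i j : Fin (length τ)) →
     lookup τ i < lookup τ j ⇔ lookup π (f i) < lookup π (f j))

Avoids : Word → Word → Set
Avoids π τ = ¬ Contains π τ

I : ℕ → List Word → Pred Word 0ℓ
I k τs π =
  IsPermutation π × Indecomposable π × length (inversions π) ≡ k × All (Avoids π) τs

-- A set of words is a predicate whose proofs need not be unique, so its
-- cardinality is that of a duplicate-free enumeration of the words themselves
-- rather than of the Σ-type of words with proofs.
HasCardinality : Pred Word 0ℓ → ℕ → Set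
HasCardinality P c = ∃[ xs ] Unique xs × (∀ x → x ∈ xs ⇔ P x) × length xs ≡ c

{-# OPTIONS --safe #-}
module Submission where

-- Both sets consist of the decreasing words n ... 2 1 of length n at least 1
-- having k inversions, so they are the same set and have the same enumeration.
--
-- That a decreasing permutation lies in both sets is immediate: each of the
-- patterns 12, 231, 312 has an ascent in its first or last two letters
-- (`decreasing⇒avoids`), and in a sum of non-empty permutations the first
-- letter of the first summand is smaller than every letter coming from the
-- second (`decreasing⇒indecomposable`).
--
-- Conversely, a permutation avoiding 12 is plainly decreasing.  Let x be the
-- first letter of a permutation avoiding 231 and 312.  By 231-avoidance no
-- letter below x follows a letter above x, so the word splits as ρ ++ σ with
-- the letters of ρ at most x and those of σ greater than x.  If σ is non-empty
-- this is a decomposition (`separated⇒sum`); otherwise x is the maximum, and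
-- 312-avoidance makes the remaining letters decrease
-- (`avoids231,312⇒decreasing`).
--
-- Finiteness holds because the first letter of a decreasing word of length
-- n + 1 forms n inversions (`length≤inversions`), which bounds n by k.

open import Data.Fin using (Fin; zero; suc) renaming (_<_ to _<ᶠ_)
open import Data.Fin.Properties using (injective⇒≤)
import Data.Fin.Properties as Fin
open import Data.List
  using (List; []; _∷_; _++_; map; length; lookup; upTo; downFrom; applyUpTo; filter;
         takeWhile; dropWhile)
open import Data.List.Membership.Propositional using (_∈_)
open import Data.List.Membership.Propositional.Properties
  using (∈-map⁺; ∈-map⁻; ∈-filter⁺; ∈-filter⁻; ∈-upTo⁺; ∈-upTo⁻; ∈-lookup; ∈-allFin;
         ∈-cartesianProduct⁺; ∈-++⁺ʳ)
open import Data.List.Properties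
  using (filter-++; filter-all; filter-none; length-map; length-upTo; length-downFrom;
         map-∘; map-cong; map-upTo; reverse-upTo; tabulate-lookup;
         ++-identityʳ; ++-cancelˡ; takeWhile++dropWhile)
open import Data.List.Relation.Binary.Permutation.Propositional
  using (_↭_; ↭-sym; ↭-trans; ↭-reflexive; ↭⇒↭ₛ)
open import Data.List.Relation.Binary.Permutation.Propositional.Properties
  using (filter-↭; ↭-length; ↭-map-inv; ↭-reverse; ∈-resp-↭)
  renaming (map⁺ to ↭-map⁺)
open import Data.List.Relation.Binary.Pointwise using (Pointwise-≡⇒≡)
open import Data.List.Relation.Unary.All as All using (All; []; _∷_; all?)
open import Data.List.Relation.Unary.All.Properties using (all-takeWhile; dropWhile⁻)
open import Data.List.Relation.Unary.AllPairs as AllPairs using (AllPairs; []; _∷_)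
import Data.List.Relation.Unary.AllPairs.Properties as AllPairs
open import Data.List.Relation.Unary.Any using (here; index)
open import Data.List.Relation.Unary.Any.Properties using (lookup-index)
open import Data.List.Relation.Unary.Sorted.TotalOrder.Properties
  using (↗↭↗⇒≋; AllPairs⇒Sorted)
open import Data.List.Relation.Unary.Unique.Propositional using (Unique)
import Data.List.Relation.Unary.Unique.Propositional.Properties as Unique
import Data.List.Relation.Binary.Permutation.Setoid.Properties as Permutationₛ
open import Data.Nat
  using (ℕ; suc; _+_; _∸_; _≤_; _<_; _>_; _≤?_; _<?_; _≟_; z≤n; s≤s; z<s; s<s)
open import Data.Nat.Properties
  using (≤-refl; ≤-trans; ≤-reflexive; <-trans; <-≤-trans; <-asym; <-irrefl; <⇒≤; <⇒≱; ≮⇒≥;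
         <-cmp; ≤∧≢⇒<; m<m+n; m+[n∸m]≡n; +-suc; suc-injective; ≤-totalOrder)
open import Data.Product using (∃-syntax; _×_; _,_; proj₁; proj₂)
open import Function using (_∘_; _⇔_; mk⇔; Equivalence; Injective)
open import Level using (0ℓ)
open import Relation.Binary.Core using (Rel)
open import Relation.Binary.Definitions using (tri<; tri≈; tri>)
open import Relation.Binary.Properties.TotalOrder ≤-totalOrder using (≥-totalOrder)
open import Relation.Binary.PropositionalEquality
  using (_≡_; _≢_; refl; sym; trans; cong; cong₂; subst; module ≡-Reasoning)
  renaming (setoid to ≡-setoid)
open import Relation.Nullary using (¬_; yes; no; contradiction)
open import Relation.Unary using (Decidable)
open import Defs

-- Pairs of positions

module _ {A : Set} {R : Rel A 0ℓ} where

  AllPairs-fromPositions : ∀ xs →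
    (∀ i j → i <ᶠ j → R (lookup xs i) (lookup xs j)) → AllPairs R xs
  AllPairs-fromPositions xs r =
    subst (AllPairs R) (tabulate-lookup xs) (AllPairs.tabulate⁺-< (r _ _))

  AllPairs-atPositions : ∀ {xs} → AllPairs R xs →
    ∀ i j → i <ᶠ j → R (lookup xs i) (lookup xs j)
  AllPairs-atPositions (r ∷ _)  zero    (suc j) _         = All.lookup r (∈-lookup j)
  AllPairs-atPositions (_ ∷ rs) (suc i) (suc j) (s<s i<j) = AllPairs-atPositions rs i j i<j

-- Permutations in one-line notation

-- The identity permutation 1 2 ... n.
identity : ℕ → Word
identity n = map suc (upTo n)

length-identity : ∀ n → length (identity n) ≡ n
length-identity n = trans (length-map suc (upTo n)) (length-upTo n)

-- The length of a rearrangement of 1, ..., n need not be checked separately.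
rearrangement⇒permutation : ∀ {π n} → π ↭ identity n → IsPermutation π
rearrangement⇒permutation {n = n} π↭ =
  subst (λ m → _ ↭ identity m) (sym (trans (↭-length π↭) (length-identity n))) π↭

∈-identity⁻ : ∀ {n x} → x ∈ identity n → 1 ≤ x × x ≤ n
∈-identity⁻ x∈ with _ , i∈ , refl ← ∈-map⁻ suc x∈ = s≤s z≤n , ∈-upTo⁻ i∈

letter-bounds : ∀ {π x} → IsPermutation π → x ∈ π → 1 ≤ x × x ≤ length π
letter-bounds perm x∈ = ∈-identity⁻ (∈-resp-↭ perm x∈)

permutation⇒unique : ∀ {π} → IsPermutation π → Unique π
permutation⇒unique {π} perm =
  Permutationₛ.Unique-resp-↭ (≡-setoid ℕ) (↭⇒↭ₛ (↭-sym perm))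
    (Unique.map⁺ suc-injective (Unique.upTo⁺ (length π)))

applyUpTo-+ : ∀ {A : Set} (f : ℕ → A) m n →
  applyUpTo f (m + n) ≡ applyUpTo f m ++ applyUpTo (f ∘ (m +_)) n
applyUpTo-+ f 0       n = refl
applyUpTo-+ f (suc m) n = cong (f 0 ∷_) (applyUpTo-+ (f ∘ suc) m n)

identity-+ : ∀ m n → identity (m + n) ≡ identity m ++ map (m +_) (identity n)
identity-+ m n = begin
  identity (m + n)
    ≡⟨ map-upTo suc (m + n) ⟩
  applyUpTo suc (m + n)
    ≡⟨ applyUpTo-+ suc m n ⟩
  applyUpTo suc m ++ applyUpTo (λ i → suc (m + i)) n
    ≡⟨ cong₂ _++_ (map-upTo suc m) (map-upTo _ n) ⟨
  identity m ++ map (λ i → suc (m + i)) (upTo n)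
    ≡⟨ cong (identity m ++_) (map-cong (λ i → sym (+-suc m i)) (upTo n)) ⟩
  identity m ++ map ((m +_) ∘ suc) (upTo n)
    ≡⟨ cong (identity m ++_) (map-∘ (upTo n)) ⟩
  identity m ++ map (m +_) (identity n)
    ∎
  where open ≡-Reasoning

-- Cutting a permutation by value

module _ {m : ℕ} where

  -- In a word consisting of letters at most m followed by letters greater than
  -- m, selecting either kind of letter recovers the corresponding factor.
  filter-low : ∀ {ρ σ} → All (_≤ m) ρ → All (m <_) σ → filter (_≤? m) (ρ ++ σ) ≡ ρ
  filter-low {ρ} {σ} low high = begin
    filter (_≤? m) (ρ ++ σ)                  ≡⟨ filter-++ (_≤? m) ρ σ ⟩
    filter (_≤? m) ρ ++ filter (_≤? m) σ     ≡⟨ cong₂ _++_ (filter-all (_≤? m) low)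
                                                  (filter-none (_≤? m) (All.map <⇒≱ high)) ⟩
    ρ ++ []                                  ≡⟨ ++-identityʳ ρ ⟩
    ρ                                        ∎
    where open ≡-Reasoning

  filter-high : ∀ {ρ σ} → All (_≤ m) ρ → All (m <_) σ → filter (m <?_) (ρ ++ σ) ≡ σ
  filter-high {ρ} {σ} low high =
    trans (filter-++ (m <?_) ρ σ)
      (cong₂ _++_ (filter-none (m <?_) (All.map (λ x≤m m<x → <⇒≱ m<x x≤m) low))
                  (filter-all (m <?_) high))

  -- A rearrangement of one separated word into another rearranges the low and
  -- the high letters individually.
  separated-↭ : ∀ {ρ σ ρ′ σ′} → All (_≤ m) ρ → All (m <_) σ → All (_≤ m) ρ′ → All (m <_) σ′ →
    ρ ++ σ ↭ ρ′ ++ σ′ → ρ ↭ ρ′ × σ ↭ σ′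
  separated-↭ {ρ} {σ} {ρ′} {σ′} low high low′ high′ p =
    select (_≤? m) (filter-low low high) (filter-low low′ high′) ,
    select (m <?_) (filter-high low high) (filter-high low′ high′)
    where
    select : ∀ {P : ℕ → Set} (P? : ∀ x → _) {α β} →
      filter {P = P} P? (ρ ++ σ) ≡ α → filter P? (ρ′ ++ σ′) ≡ β → α ↭ β
    select P? refl refl = filter-↭ P? p

-- A permutation whose letters at most m all precede those greater than m is a
-- sum of permutations of lengths m and length π - m.
separated⇒sum : ∀ {m ρ σ} → All (_≤ m) ρ → All (m <_) σ → m ≤ length (ρ ++ σ) →
  IsPermutation (ρ ++ σ) →
  IsPermutation ρ × ∃[ τ ] IsPermutation τ × ρ ++ σ ≡ ρ ⊕ τ
separated⇒sum {m} {ρ} {σ} low high m≤ perm =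
  let d = length (ρ ++ σ) ∸ m
      π↭ : ρ ++ σ ↭ identity m ++ map (m +_) (identity d)
      π↭ = ↭-trans perm (↭-reflexive
             (trans (cong identity (sym (m+[n∸m]≡n m≤))) (identity-+ m d)))
      ρ↭ , σ↭ = separated-↭ low high low-identity (high-shift d) π↭
      τ , σ≡ , τ↭ = ↭-map-inv (m +_) (↭-sym σ↭)
      |ρ|≡m = trans (↭-length ρ↭) (length-identity m)
  in rearrangement⇒permutation ρ↭ , τ , rearrangement⇒permutation (↭-sym τ↭) ,
     cong (ρ ++_) (trans σ≡ (cong (λ l → map (l +_) τ) (sym |ρ|≡m)))
  where
  low-identity : All (_≤ m) (identity m)
  low-identity = All.tabulate (proj₂ ∘ ∈-identity⁻)

  high-shift : ∀ d → All (m <_) (map (m +_) (identity d))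
  high-shift d = All.tabulate above
    where
    above : ∀ {x} → x ∈ map (m +_) (identity d) → m < x
    above x∈ with y , y∈ , refl ← ∈-map⁻ (m +_) x∈ = m<m+n m (proj₁ (∈-identity⁻ y∈))

-- Decreasing words

Decreasing : Word → Set
Decreasing = AllPairs _>_

-- The decreasing permutation n ... 2 1.
descending : ℕ → Word
descending n = map suc (downFrom n)

length-descending : ∀ n → length (descending n) ≡ n
length-descending n = trans (length-map suc (downFrom n)) (length-downFrom n)

descending-permutation : ∀ n → IsPermutation (descending n)
descending-permutation n = rearrangement⇒permutation
  (↭-map⁺ suc (↭-trans (↭-reflexive (sym (reverse-upTo n))) (↭-reverse (upTo n))))

descending-decreasing : ∀ n → Decreasing (descending n)
descending-decreasing n = AllPairs.map⁺ (AllPairs.applyDownFrom⁺₁ _ n (λ j<i _ → s<s j<i))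

descending-injective : ∀ {m n} → descending m ≡ descending n → m ≡ n
descending-injective {m} {n} eq =
  trans (sym (length-descending m)) (trans (cong length eq) (length-descending n))

decreasing-permutation≡descending : ∀ {π} → IsPermutation π → Decreasing π →
  π ≡ descending (length π)
decreasing-permutation≡descending {π} perm dec =
  Pointwise-≡⇒≡ (↗↭↗⇒≋ ≥-totalOrder (sorted dec) (sorted (descending-decreasing n))
    (↭⇒↭ₛ (↭-trans perm (↭-sym descending↭))))
  where
  n = length π

  sorted : ∀ {xs} → Decreasing xs → _
  sorted = AllPairs⇒Sorted ≥-totalOrder ∘ AllPairs.map <⇒≤

  descending↭ : descending n ↭ identity n
  descending↭ = subst (λ l → descending n ↭ identity l)
    (length-descending n) (descending-permutation n)

decreasing-fromAscentFree : ∀ {xs} → Unique xs → AllPairs (λ x y → ¬ x < y) xs → Decreasing xs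
decreasing-fromAscentFree uniq noAscent =
  AllPairs.zipWith (λ (x≢y , x≮y) → ≤∧≢⇒< (≮⇒≥ x≮y) (x≢y ∘ sym)) (uniq , noAscent)

-- In a sum of non-empty permutations the first letters of the two summands form
-- an ascent.
decreasing⇒indecomposable : ∀ {π} → Decreasing π → ¬ Decomposable π
decreasing⇒indecomposable _   ([] , _ , _ , _ , ρ≢[] , _) = ρ≢[] refl
decreasing⇒indecomposable _   (_ ∷ _ , [] , _ , _ , _ , τ≢[] , _) = τ≢[] refl
decreasing⇒indecomposable (x> ∷ _) (x ∷ ρ , t ∷ τ , permρ , permτ , _ , _ , refl) =
  <-asym (All.lookup x> (∈-++⁺ʳ ρ (here refl)))
    (<-≤-trans (s≤s (proj₂ (letter-bounds permρ (here refl))))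
               (m<m+n (suc (length ρ)) (proj₁ (letter-bounds permτ (here refl)))))

-- Some letter, not necessarily the next one, exceeds an earlier letter.
HasAscent : Word → Set
HasAscent τ = ∃[ i ] ∃[ j ] i <ᶠ j × lookup τ i < lookup τ j

decreasing⇒avoids : ∀ {π τ} → HasAscent τ → Decreasing π → Avoids π τ
decreasing⇒avoids (i , j , i<j , τi<τj) dec (f , mono , iso) =
  <-asym (AllPairs-atPositions dec (f i) (f j) (mono i j i<j))
         (Equivalence.to (iso i j) τi<τj)

-- The first letter exceeds every other letter, so it forms an inversion with
-- each of them.
length≤inversions : ∀ {x xs} → Decreasing (x ∷ xs) → length xs ≤ length (inversions (x ∷ xs))
length≤inversions {x} {xs} dec = injective⇒≤ position-injective
  where
  π = x ∷ xs

  inversion : ∀ i → (zero , suc i) ∈ inversions π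
  inversion i = ∈-filter⁺ (isInversion? π)
    (∈-cartesianProduct⁺ (∈-allFin zero) (∈-allFin (suc i)))
    (z<s , AllPairs-atPositions dec zero (suc i) z<s)

  position : Fin (length xs) → Fin (length (inversions π))
  position i = index (inversion i)

  position-injective : Injective _≡_ _≡_ position
  position-injective {i} {j} eq
    with refl ← trans (lookup-index (inversion i))
                  (trans (cong (lookup (inversions π)) eq) (sym (lookup-index (inversion j)))) = refl

-- Avoidance

-- An increasing choice of positions that preserves the strict order of the
-- letters also reflects it when the letters of the pattern are distinct.
contains : ∀ π {τ} → Unique τ → (f : Fin (length τ) → Fin (length π)) →
  (∀ i j → i <ᶠ j → f i <ᶠ f j) →
  (∀ i j → lookup τ i < lookup τ j → lookup π (f i) < lookup π (f j)) →
  Contains π τ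
contains π {τ} uniq f mono pres = f , mono , λ i j → mk⇔ (pres i j) (reflect i j)
  where
  distinct : ∀ i j → lookup τ i ≡ lookup τ j → i ≡ j
  distinct i j eq with Fin.<-cmp i j
  ... | tri< i<j _ _ = contradiction eq (AllPairs-atPositions uniq i j i<j)
  ... | tri≈ _ i≡j _ = i≡j
  ... | tri> _ _ j<i = contradiction (sym eq) (AllPairs-atPositions uniq j i j<i)

  reflect : ∀ i j → lookup π (f i) < lookup π (f j) → lookup τ i < lookup τ j
  reflect i j πi<πj with <-cmp (lookup τ i) (lookup τ j)
  ... | tri< τi<τj _ _ = τi<τj
  ... | tri> _ _ τj<τi = contradiction πi<πj (<-asym (pres j i τj<τi))
  ... | tri≈ _ τi≡τj _ with refl ← distinct i j τi≡τj = contradiction πi<πj (<-irrefl refl)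

avoids12⇒ascentFree : ∀ {π} → Avoids π (1 ∷ 2 ∷ []) → AllPairs (λ x y → ¬ x < y) π
avoids12⇒ascentFree {π} av = AllPairs-fromPositions π λ i j i<j πi<πj →
  av (contains π (((λ ()) ∷ []) ∷ [] ∷ [])
    (λ { zero → i ; (suc zero) → j })
    (λ { zero (suc zero) _ → i<j ; (suc zero) (suc zero) (s≤s ()) })
    (λ { zero       zero       (s≤s ())
       ; zero       (suc zero) _ → πi<πj
       ; (suc zero) zero       (s≤s ())
       ; (suc zero) (suc zero) (s≤s (s≤s ())) }))

-- The first letter x of the word together with positions i < j of the tail, as
-- a choice of three positions.
firstAnd : ∀ {n} → Fin n → Fin n → Fin 3 → Fin (suc n)
firstAnd i j zero             = zero
firstAnd i j (suc zero)       = suc i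
firstAnd i j (suc (suc zero)) = suc j

firstAnd-mono : ∀ {n} {i j : Fin n} → i <ᶠ j → ∀ p q → p <ᶠ q → firstAnd i j p <ᶠ firstAnd i j q
firstAnd-mono i<j zero             (suc zero)       _ = z<s
firstAnd-mono i<j zero             (suc (suc zero)) _ = z<s
firstAnd-mono i<j (suc zero)       (suc (suc zero)) _ = s<s i<j
firstAnd-mono i<j (suc zero)       (suc zero)       (s≤s ())
firstAnd-mono i<j (suc (suc zero)) (suc zero)       (s≤s ())
firstAnd-mono i<j (suc (suc zero)) (suc (suc zero)) (s≤s (s≤s ()))

-- No letter below the first letter comes after a letter above the first letter.
avoids231⇒ : ∀ {x xs} → Avoids (x ∷ xs) (2 ∷ 3 ∷ 1 ∷ []) →
  AllPairs (λ y z → ¬ (z < x × x < y)) xs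
avoids231⇒ {x} {xs} av = AllPairs-fromPositions xs λ i j i<j (z<x , x<y) →
  av (contains (x ∷ xs) (((λ ()) ∷ (λ ()) ∷ []) ∷ ((λ ()) ∷ []) ∷ [] ∷ [])
    (firstAnd i j) (firstAnd-mono i<j)
    (λ { zero             zero             (s≤s (s≤s ()))
       ; zero             (suc zero)       _ → x<y
       ; zero             (suc (suc zero)) (s≤s ())
       ; (suc zero)       zero             (s≤s (s≤s ()))
       ; (suc zero)       (suc zero)       (s≤s (s≤s (s≤s ())))
       ; (suc zero)       (suc (suc zero)) (s≤s ())
       ; (suc (suc zero)) zero             _ → z<x
       ; (suc (suc zero)) (suc zero)       _ → <-trans z<x x<y
       ; (suc (suc zero)) (suc (suc zero)) (s≤s ()) }))

-- The letters below the first letter contain no ascent.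
avoids312⇒ : ∀ {x xs} → Avoids (x ∷ xs) (3 ∷ 1 ∷ 2 ∷ []) →
  AllPairs (λ y z → ¬ (y < z × z < x)) xs
avoids312⇒ {x} {xs} av = AllPairs-fromPositions xs λ i j i<j (y<z , z<x) →
  av (contains (x ∷ xs) (((λ ()) ∷ (λ ()) ∷ []) ∷ ((λ ()) ∷ []) ∷ [] ∷ [])
    (firstAnd i j) (firstAnd-mono i<j)
    (λ { zero             zero             (s≤s (s≤s (s≤s ())))
       ; zero             (suc zero)       (s≤s ())
       ; zero             (suc (suc zero)) (s≤s (s≤s ()))
       ; (suc zero)       zero             _ → <-trans y<z z<x
       ; (suc zero)       (suc zero)       (s≤s ())
       ; (suc zero)       (suc (suc zero)) _ → y<z
       ; (suc (suc zero)) zero             _ → z<x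
       ; (suc (suc zero)) (suc zero)       (s≤s ())
       ; (suc (suc zero)) (suc (suc zero)) (s≤s (s≤s ())) }))

avoids12⇒decreasing : ∀ {π} → IsPermutation π → Avoids π (1 ∷ 2 ∷ []) → Decreasing π
avoids12⇒decreasing perm av =
  decreasing-fromAscentFree (permutation⇒unique perm) (avoids12⇒ascentFree av)

-- If no letter below x follows a letter above x, then from the first letter
-- not below x onwards all letters exceed x.
dropBelow-above : ∀ {x xs} (below? : Decidable (_< x)) → All (x ≢_) xs →
  AllPairs (λ y z → ¬ (z < x × x < y)) xs → All (x <_) (dropWhile below? xs)
dropBelow-above              below? []          []         = []
dropBelow-above {x} {y ∷ xs} below? (x≢y ∷ x≢s) (ny ∷ nxs) with below? y
... | yes _   = dropBelow-above below? x≢s nxs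
... | no  y≮x = x<y ∷ All.zipWith (λ (x≢z , nz) → ≤∧≢⇒< (≮⇒≥ λ z<x → nz (z<x , x<y)) x≢z) (x≢s , ny)
  where
  x<y : x < y
  x<y = ≤∧≢⇒< (≮⇒≥ y≮x) x≢y

avoids231,312⇒decreasing : ∀ {π} → IsPermutation π → ¬ Decomposable π →
  Avoids π (2 ∷ 3 ∷ 1 ∷ []) → Avoids π (3 ∷ 1 ∷ 2 ∷ []) → Decreasing π
avoids231,312⇒decreasing {[]}     _    _     _     _ = []
avoids231,312⇒decreasing {x ∷ xs} perm indec av231 av312
  with x≢xs ∷ uniq ← permutation⇒unique perm
  with all? (_<? x) xs
-- The first letter is the maximum.
... | yes xs<x = xs<x ∷ decreasing-fromAscentFree uniq
                   (tailAscentFree xs<x (avoids312⇒ av312))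
  where
  tailAscentFree : ∀ {ys} → All (_< x) ys → AllPairs (λ y z → ¬ (y < z × z < x)) ys →
    AllPairs (λ y z → ¬ y < z) ys
  tailAscentFree []       []       = []
  tailAscentFree (_ ∷ <x) (n ∷ ns) =
    All.zipWith (λ (z<x , nz) y<z → nz (y<z , z<x)) (<x , n) ∷ tailAscentFree <x ns
-- Some letter exceeds x: cut where the first such letter occurs.
... | no xs≮x = contradiction decomposition indec
  where
  ρ σ : Word
  ρ = x ∷ takeWhile (_<? x) xs
  σ = dropWhile (_<? x) xs

  π≡ : x ∷ xs ≡ ρ ++ σ
  π≡ = cong (x ∷_) (sym (takeWhile++dropWhile (_<? x) xs))

  low : All (_≤ x) ρ
  low = ≤-refl ∷ All.map <⇒≤ (all-takeWhile (_<? x) xs)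

  high : All (x <_) σ
  high = dropBelow-above (_<? x) x≢xs (avoids231⇒ av231)

  decomposition : Decomposable (x ∷ xs)
  decomposition
    with permρ , τ , permτ , ρσ≡ ← separated⇒sum low high
           (subst (λ π → x ≤ length π) π≡ (proj₂ (letter-bounds perm (here refl))))
           (subst IsPermutation π≡ perm)
    = ρ , τ , permρ , permτ , (λ ()) , τ≢[] , trans π≡ ρσ≡
    where
    τ≢[] : τ ≢ []
    τ≢[] refl = xs≮x (dropWhile⁻ (_<? x) (++-cancelˡ ρ σ [] ρσ≡))

-- Enumeration

-- Every indecomposable permutation avoiding all the listed patterns is
-- decreasing.
ForcesDecreasing : List Word → Set
ForcesDecreasing τs = ∀ {π} → IsPermutation π → ¬ Decomposable π →
  All (Avoids π) τs → Decreasing π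

hasInversions? : ∀ k → Decidable (λ π → length (inversions π) ≡ k)
hasInversions? k π = length (inversions π) ≟ k

-- The descending permutations of lengths 1, ..., k + 1; longer ones have more
-- than k inversions.
candidates : ℕ → List Word
candidates k = map (descending ∘ suc) (upTo (suc k))

-- The enumeration common to both sets: all non-empty decreasing permutations
-- with k inversions.
decreasingWords : ℕ → List Word
decreasingWords k = filter (hasInversions? k) (candidates k)

decreasingWords-unique : ∀ k → Unique (decreasingWords k)
decreasingWords-unique k = Unique.filter⁺ (hasInversions? k)
  (Unique.map⁺ (suc-injective ∘ descending-injective) (Unique.upTo⁺ (suc k)))

∈-decreasingWords : ∀ {k τs} → All HasAscent τs → ForcesDecreasing τs →
  ∀ π → π ∈ decreasingWords k ⇔ I k τs π
∈-decreasingWords {k} {τs} ascents forces π = mk⇔ to (from π)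
  where
  to : π ∈ decreasingWords k → I k τs π
  to π∈ with π∈′ , inv≡k ← ∈-filter⁻ (hasInversions? k) {xs = candidates k} π∈
        with n , _ , refl ← ∈-map⁻ (descending ∘ suc) π∈′ =
    let dec = descending-decreasing (suc n) in
    descending-permutation (suc n) , ((λ ()) , decreasing⇒indecomposable dec) , inv≡k ,
    All.map (λ {τ} ascent → decreasing⇒avoids {τ = τ} ascent dec) ascents

  from : ∀ π → I k τs π → π ∈ decreasingWords k
  from []       (_ , (π≢[] , _) , _ , _) = contradiction refl π≢[]
  from (x ∷ xs) (perm , (_ , indec) , inv≡k , avoids) =
    ∈-filter⁺ (hasInversions? k)
      (subst (_∈ candidates k)
        (sym (decreasing-permutation≡descending perm dec))
        (∈-map⁺ (descending ∘ suc)
          (∈-upTo⁺ (s≤s (≤-trans (length≤inversions dec) (≤-reflexive inv≡k))))))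
      inv≡k
    where
    dec : Decreasing (x ∷ xs)
    dec = forces perm indec avoids

cardinality : ∀ {k τs} → All HasAscent τs → ForcesDecreasing τs →
  HasCardinality (I k τs) (length (decreasingWords k))
cardinality {k} ascents forces =
  decreasingWords k , decreasingWords-unique k , ∈-decreasingWords ascents forces , refl

theorem11 : (k : ℕ) → ∃[ c ]
    HasCardinality (I k ((2 ∷ 3 ∷ 1 ∷ []) ∷ (3 ∷ 1 ∷ 2 ∷ []) ∷ [])) c ×
    HasCardinality (I k ((1 ∷ 2 ∷ []) ∷ [])) c
theorem11 k = length (decreasingWords k) ,
  cardinality
    ( (zero , suc zero , z<s , ≤-refl)
    ∷ (suc zero , suc (suc zero) , s<s z<s , ≤-refl)
    ∷ [])
    (λ { perm indec (av231 ∷ av312 ∷ []) → avoids231,312⇒decreasing perm indec av231 av312 }) ,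
  cardinality
    ((zero , suc zero , z<s , ≤-refl) ∷ [])
    (λ { perm _ (av12 ∷ []) → avoids12⇒decreasing perm av12 })
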